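{- Let $\mathcal{B}$ be a finite connected undirected graph with $\beta(\mathcal{B})\geq 2$. Then the total number of pivot vertices in $\mathcal{B}$ is at most $3(\beta(\mathcal{B})-1)$.
   Context: A finite undirected graph $\mathcal{B}$ has a finite vertex set $\mathcal{V}$ and an edge set $\mathcal{E}$ of $2$-element subsets of $\mathcal{V}$. For a group $G$ acting on $\mathcal{B}$ by graph automorphisms, a vertex $v$ is a $G$-pivot vertex if for every $w\in\mathcal{V}$ with $\{v,w\}\in\mathcal{E}$, the set $\{gw\mid g\in G,\ gv=v\}$ has even cardinality; a pivot vertex of $\mathcal{B}$ is a $G$-pivot vertex for $G=\mathrm{Aut}(\mathcal{B})$. The Betti number is $\beta(\mathcal{B})=|\mathcal{E}|-|\mathcal{V}|+1$. -}

module Defs where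

open import Data.Nat using (ℕ; suc; _+_; _*_; _∸_; _≤_; _<ᵇ_)
open import Data.Fin using (Fin; toℕ)
open import Data.Fin.Permutation using (Permutation′; _⟨$⟩ʳ_)
open import Data.Bool using (Bool; true; false; _∧_)
open import Data.List using (List; length; filterᵇ; allFin; concatMap; map)
open import Data.Product using (Σ; _×_; _,_; ∃-syntax)
open import Relation.Binary.PropositionalEquality using (_≡_)
open import Function.Definitions using (Injective)
open import Data.Nat.Divisibility using (_∣_)

record Graph (n : ℕ) : Set where
  field
    adj   : Fin n → Fin n → Bool
    sym   : ∀ i j → adj i j ≡ adj j i
    irrefl : ∀ i → adj i i ≡ false
open Graph public

Adj : ∀ {n} → Graph n → Fin n → Fin n → Set
Adj G i j = adj G i j ≡ true

edgeList : ∀ {n} → Graph n → List (Fin n × Fin n)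
edgeList {n} G =
  filterᵇ (λ { (i , j) → (toℕ i <ᵇ toℕ j) ∧ adj G i j })
    (concatMap (λ i → map (λ j → (i , j)) (allFin n)) (allFin n))

numEdges : ∀ {n} → Graph n → ℕ
numEdges G = length (edgeList G)

data Walk {n} (G : Graph n) : Fin n → Fin n → Set where
  here : ∀ {u} → Walk G u u
  step : ∀ {u v w} → Adj G u v → Walk G v w → Walk G u w

Connected : ∀ {n} → Graph n → Set
Connected G = ∀ u v → Walk G u v

IsAut : ∀ {n} → Graph n → Permutation′ n → Set
IsAut G π = ∀ i j → adj G (π ⟨$⟩ʳ i) (π ⟨$⟩ʳ j) ≡ adj G i j

InStabOrbit : ∀ {n} → Graph n → Fin n → Fin n → Fin n → Set
InStabOrbit G v w u =
  Σ (Permutation′ _) λ π → IsAut G π × (π ⟨$⟩ʳ v ≡ v) × (π ⟨$⟩ʳ w ≡ u)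

HasCard : ∀ {n} → (Fin n → Set) → ℕ → Set
HasCard {n} P k =
  Σ (Fin k → Fin n) λ f → Injective _≡_ _≡_ f ×
    ((∀ a → P (f a)) × (∀ u → P u → ∃[ a ] f a ≡ u))

IsPivot : ∀ {n} → Graph n → Fin n → Set
IsPivot G v = ∀ w → Adj G v w → ∀ k → HasCard (InStabOrbit G v w) k → 2 ∣ k

{-# OPTIONS --safe #-}
module Submission where

-- Deleting leaves one by one ends in a connected core C with the same Betti number and
-- Σ_{v∈C} (deg_C v − 2) = 2 (β − 1). It is the largest vertex set in which every vertex has
-- two neighbours, hence Aut-invariant. A vertex outside C has a unique neighbour leading towards
-- C, fixed by its stabiliser, so every pivot lies in C; its degree in C is not 3, since a
-- 3-element set is not a union of disjoint sets of even size. If the degree is 2, an automorphism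
-- fixing the pivot swaps its two neighbours and so reflects the path of degree-2 vertices through
-- it: the pivot is the midpoint of a path between branch vertices (vertices with degree at
-- least 3 in C), and it is charged to the two directed edges with which that path leaves its
-- ends. A pivot of degree d ≥ 4 is charged twice to itself. Each branch vertex thus pays
-- d (+ 2 if d ≥ 4) ≤ 3 (d − 2), so twice the number of pivots is at most 6 (β − 1).
-- Automorphisms are only obtained under double negation, which is harmless as ≤ is decidable.

open import Defs
open import Data.Nat using (ℕ; _+_; _*_; _∸_; _≤_)
open import Data.Fin using (Fin)
open import Function.Definitions using (Injective)
open import Relation.Binary.PropositionalEquality using (_≡_)

open import Data.Bool using (Bool; true; false; _∧_; not; T?)
import Data.Bool as Bool
open import Data.Bool.Properties using (T-≡; T-∧; ∧-zeroʳ; ∧-identityʳ)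
open import Data.Empty using (⊥; ⊥-elim)
open import Data.Fin using (zero; suc; toℕ; combine; remQuot)
open import Data.Fin.Permutation as Perm using (Permutation′; _⟨$⟩ʳ_; _⟨$⟩ˡ_; _∘ₚ_)
open import Data.Fin.Properties using (_≟_; any?; toℕ-injective; injective⇒≤; combine-remQuot; sequence)
open import Data.List using (List; []; _∷_; _++_; length; filterᵇ; allFin; concatMap; map; lookup; tabulate)
open import Data.List.Membership.Propositional using (_∈_; lose)
open import Data.List.Membership.Propositional.Properties using (∈-filter⁺; ∈-filter⁻; ∈-allFin; ∈-map⁺; ∈-++⁺ˡ; ∈-++⁺ʳ; ∈-concatMap⁺)
open import Data.List.Properties using (filter-++; length-++; length-map; map-tabulate)
open import Data.List.Relation.Unary.All using ([]; _∷_)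
open import Data.List.Relation.Unary.Any using (here; there; index)
open import Data.List.Relation.Unary.Any.Properties using (lookup-index)
open import Data.List.Relation.Unary.AllPairs using ([]; _∷_)
open import Data.List.Relation.Unary.Unique.Propositional using (Unique)
open import Data.List.Relation.Unary.Unique.Propositional.Properties using (filter⁺; allFin⁺)
open import Data.Nat using (zero; suc; _<_; _<ᵇ_; z≤n; s≤s; s≤s⁻¹; _≤?_)
open import Data.Nat.Divisibility using (_∣?_)
open import Data.Nat.Properties hiding (_≟_)
import Data.Nat.Properties as ℕ
open import Data.Nat.Tactic.RingSolver using (solve-∀)
open import Data.Product using (Σ; _×_; _,_; proj₁; proj₂; ∃; ∃₂; ∃-syntax; uncurry)
open import Data.Sum using (_⊎_; inj₁; inj₂)
open import Effect.Monad using (RawMonad)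
open import Function using (_∘_; _∋_; Equivalence)
open import Relation.Binary using (tri<; tri≈; tri>)
open import Relation.Binary.PropositionalEquality as ≡ using (_≢_; refl; cong; cong₂; trans; subst; module ≡-Reasoning)
open import Relation.Nullary using (¬_; Dec; yes; no; does; contradiction)
open import Relation.Nullary.Decidable using (decidable-stable; from-no; ¬¬-excluded-middle; _×-dec_)
open import Relation.Nullary.Negation using (¬¬-Monad)
open import Algebra.Properties.Semiring.Sum +-*-semiring using (sum; sum-syntax; sum-cong-≗; ∑-distrib-+; ∑-comm; ∑-permute; sum-replicate-zero; *-distribˡ-sum)

-- Finite sums and lengths of lists

⟦_⟧ : Bool → ℕ
⟦ true ⟧  = 1
⟦ false ⟧ = 0

sum-mono : ∀ {n} {f g : Fin n → ℕ} → (∀ i → f i ≤ g i) → sum f ≤ sum g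
sum-mono {zero}  f≤g = z≤n
sum-mono {suc n} f≤g = +-mono-≤ (f≤g zero) (sum-mono (f≤g ∘ suc))

sum-1 : ∀ n → ∑[ i < n ] 1 ≡ n
sum-1 zero    = refl
sum-1 (suc n) = cong suc (sum-1 n)

sum-δ : ∀ {n} (x : Fin n) (f : Fin n → ℕ) → ∑[ i < n ] (⟦ does (i ≟ x) ⟧ * f i) ≡ f x
sum-δ {suc n} zero    f = trans (cong₂ _+_ (*-identityˡ (f zero)) (sum-replicate-zero n)) (+-identityʳ _)
sum-δ {suc n} (suc x) f = sum-δ x (f ∘ suc)

length-filterᵇ-tabulate : ∀ {A : Set} {n} (p : A → Bool) (f : Fin n → A) →
  length (filterᵇ p (tabulate f)) ≡ ∑[ i < n ] ⟦ p (f i) ⟧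
length-filterᵇ-tabulate {n = zero}  p f = refl
length-filterᵇ-tabulate {n = suc n} p f with p (f zero)
... | true  = cong suc (length-filterᵇ-tabulate p (f ∘ suc))
... | false = length-filterᵇ-tabulate p (f ∘ suc)

length-filterᵇ-concatMap : ∀ {A B : Set} {n} (p : B → Bool) (h : A → List B) (f : Fin n → A) →
  length (filterᵇ p (concatMap h (tabulate f))) ≡ ∑[ i < n ] length (filterᵇ p (h (f i)))
length-filterᵇ-concatMap {n = zero}  p h f = refl
length-filterᵇ-concatMap {n = suc n} p h f
  rewrite filter-++ (T? ∘ p) (h (f zero)) (concatMap h (tabulate (f ∘ suc)))
        | length-++ (filterᵇ p (h (f zero))) {filterᵇ p (concatMap h (tabulate (f ∘ suc)))}
  = cong (_ +_) (length-filterᵇ-concatMap p h (f ∘ suc))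

length-filterᵇ-pairs : ∀ n (p : Fin n × Fin n → Bool) →
  length (filterᵇ p (concatMap (λ i → map (λ j → (i , j)) (allFin n)) (allFin n))) ≡
  ∑[ i < n ] ∑[ j < n ] ⟦ p (i , j) ⟧
length-filterᵇ-pairs n p =
  trans (length-filterᵇ-concatMap p (λ i → map (i ,_) (allFin n)) (λ i → i))
    (sum-cong-≗ λ i → trans (cong (length ∘ filterᵇ p) (map-tabulate (λ j → j) (i ,_)))
                            (length-filterᵇ-tabulate p (i ,_)))

length-concatMap : ∀ {A B : Set} {n} (h : A → List B) (f : Fin n → A) →
  length (concatMap h (tabulate f)) ≡ ∑[ i < n ] length (h (f i))
length-concatMap {n = zero}  h f = refl
length-concatMap {n = suc n} h f =
  trans (length-++ (h (f zero))) (cong (_ +_) (length-concatMap h (f ∘ suc)))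

injective-into-list : ∀ {A : Set} {m} {xs : List A} (f : Fin m → A) →
  Injective _≡_ _≡_ f → (∀ a → f a ∈ xs) → m ≤ length xs
injective-into-list {xs = xs} f inj f∈xs = injective⇒≤ {f = λ a → index (f∈xs a)} λ {a} {b} eq →
  inj (trans (lookup-index (f∈xs a)) (trans (cong (lookup xs) eq) (≡.sym (lookup-index (f∈xs b)))))

at-most-two : ∀ {A : Set} {x y z : A} (xs : List A) → length xs ≤ 2 →
  x ∈ xs → y ∈ xs → z ∈ xs → x ≢ y → x ≢ z → y ≡ z
at-most-two (a ∷ b ∷ c ∷ xs) (s≤s (s≤s ()))
at-most-two _ _ (here refl) (here refl) _ x≢y _ = contradiction refl x≢y
at-most-two _ _ (here refl) (there _) (here refl) _ x≢z = contradiction refl x≢z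
at-most-two (a ∷ b ∷ []) _ (here refl) (there (here refl)) (there (here refl)) _ _ = refl
at-most-two (a ∷ b ∷ []) _ (there (here refl)) (there (here refl)) _ x≢y _ = contradiction refl x≢y
at-most-two (a ∷ b ∷ []) _ (there (here refl)) (here refl) (here refl) _ _ = refl
at-most-two (a ∷ b ∷ []) _ (there (here refl)) (here refl) (there (here refl)) _ x≢z = contradiction refl x≢z

true≢false : true ≢ false
true≢false ()

-- Edge counts, neighbours and degrees inside a vertex set

module _ {n : ℕ} (G : Graph n) where

  numEdges≡∑ : numEdges G ≡ ∑[ i < n ] ∑[ j < n ] ⟦ (toℕ i <ᵇ toℕ j) ∧ adj G i j ⟧
  numEdges≡∑ = length-filterᵇ-pairs n _

  -- Of the two orientations of an edge, `edgeList` keeps the increasing one, so the adjacency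
  -- matrix is `e` plus its transpose; on the diagonal irreflexivity makes everything zero.
  handshake : ∑[ i < n ] ∑[ j < n ] ⟦ adj G i j ⟧ ≡ 2 * numEdges G
  handshake = begin
    ∑[ i < n ] ∑[ j < n ] ⟦ adj G i j ⟧
      ≡⟨ sum-cong-≗ (λ i → trans (sum-cong-≗ (split i)) (∑-distrib-+ (e i) (λ j → e j i))) ⟩
    ∑[ i < n ] (∑[ j < n ] e i j + ∑[ j < n ] e j i)
      ≡⟨ ∑-distrib-+ (λ i → ∑[ j < n ] e i j) (λ i → ∑[ j < n ] e j i) ⟩
    ∑[ i < n ] ∑[ j < n ] e i j + ∑[ i < n ] ∑[ j < n ] e j i
      ≡⟨ cong (∑[ i < n ] ∑[ j < n ] e i j +_) (∑-comm (λ i j → e j i)) ⟩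
    ∑[ i < n ] ∑[ j < n ] e i j + ∑[ i < n ] ∑[ j < n ] e i j
      ≡⟨ cong₂ _+_ numEdges≡∑ numEdges≡∑ ⟨
    numEdges G + numEdges G
      ≡⟨ cong (numEdges G +_) (+-identityʳ _) ⟨
    2 * numEdges G ∎
    where
    open ≡-Reasoning
    e : Fin n → Fin n → ℕ
    e i j = ⟦ (toℕ i <ᵇ toℕ j) ∧ adj G i j ⟧
    <ᵇ-true : ∀ {a b} → a < b → (a <ᵇ b) ≡ true
    <ᵇ-true a<b = Equivalence.to T-≡ (<⇒<ᵇ a<b)
    <ᵇ-false : ∀ {a b} → ¬ (a < b) → (a <ᵇ b) ≡ false
    <ᵇ-false {a} {b} a≮b with a <ᵇ b in eq
    ... | true  = contradiction (<ᵇ⇒< a b (Equivalence.from T-≡ eq)) a≮b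
    ... | false = refl
    split : ∀ i j → ⟦ adj G i j ⟧ ≡ e i j + e j i
    split i j with <-cmp (toℕ i) (toℕ j)
    ... | tri< i<j _ j≮i rewrite <ᵇ-true i<j | <ᵇ-false j≮i = ≡.sym (+-identityʳ _)
    ... | tri> i≮j _ j<i rewrite <ᵇ-true j<i | <ᵇ-false i≮j = cong ⟦_⟧ (Defs.sym G i j)
    ... | tri≈ i≮j i≡j _ rewrite toℕ-injective i≡j | <ᵇ-false (<-irrefl {toℕ j} refl) =
      cong ⟦_⟧ (irrefl G j)

  adj-sym : ∀ {u v} → Adj G u v → Adj G v u
  adj-sym {u} {v} uv = trans (Defs.sym G v u) uv

  Nbr : (Fin n → Bool) → Fin n → Fin n → Set
  Nbr C v w = C w ≡ true × Adj G v w

  nbrs : (Fin n → Bool) → Fin n → List (Fin n)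
  nbrs C v = filterᵇ (λ w → C w ∧ adj G v w) (allFin n)

  deg : (Fin n → Bool) → Fin n → ℕ
  deg C v = length (nbrs C v)

  card : (Fin n → Bool) → ℕ
  card C = ∑[ i < n ] ⟦ C i ⟧

  -- Twice the number of edges of the subgraph induced on `C`.
  darts : (Fin n → Bool) → ℕ
  darts C = ∑[ i < n ] ∑[ j < n ] ⟦ C i ∧ (C j ∧ adj G i j) ⟧

  ∈-nbrs⁺ : ∀ {C v w} → Nbr C v w → w ∈ nbrs C v
  ∈-nbrs⁺ {C} {v} {w} (Cw , vw) = ∈-filter⁺ (T? ∘ _) (∈-allFin w)
    (Equivalence.from T-∧ (Equivalence.from T-≡ Cw , Equivalence.from T-≡ vw))

  ∈-nbrs⁻ : ∀ {C v w} → w ∈ nbrs C v → Nbr C v w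
  ∈-nbrs⁻ {C} {v} {w} w∈ with Equivalence.to T-∧ (proj₂ (∈-filter⁻ (T? ∘ _) {xs = allFin n} w∈))
  ... | Cw , vw = Equivalence.to T-≡ Cw , Equivalence.to T-≡ vw

  nbrs-unique : ∀ C v → Unique (nbrs C v)
  nbrs-unique C v = filter⁺ (T? ∘ _) (allFin⁺ n)

  deg≡∑ : ∀ C v → deg C v ≡ ∑[ w < n ] ⟦ C w ∧ adj G v w ⟧
  deg≡∑ C v = length-filterᵇ-tabulate (λ w → C w ∧ adj G v w) (λ w → w)

  darts≡∑ : ∀ C → darts C ≡ ∑[ v < n ] (⟦ C v ⟧ * deg C v)
  darts≡∑ C = sum-cong-≗ row
    where
    row : ∀ v → ∑[ j < n ] ⟦ C v ∧ (C j ∧ adj G v j) ⟧ ≡ ⟦ C v ⟧ * deg C v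
    row v with C v
    ... | true  = trans (≡.sym (deg≡∑ C v)) (≡.sym (*-identityˡ _))
    ... | false = sum-replicate-zero n

  two-nbrs : ∀ C v → 2 ≤ deg C v → ∃₂ λ y z → y ≢ z × Nbr C v y × Nbr C v z
  two-nbrs C v 2≤d with nbrs C v | nbrs-unique C v | (λ {w} → ∈-nbrs⁻ {C} {v} {w})
  ... | y ∷ z ∷ _ | (y≢z ∷ _) ∷ _ | nbr = y , z , y≢z , nbr (here refl) , nbr (there (here refl))
  ... | y ∷ [] | _ | _ = contradiction 2≤d λ { (s≤s ()) }

  one-nbr : ∀ C v → deg C v ≡ 1 → ∃ λ y → Nbr C v y × (∀ {z} → Nbr C v z → z ≡ y)
  one-nbr C v d≡1 with nbrs C v | (λ {w} → ∈-nbrs⁻ {C} {v} {w}) | (λ {w} → ∈-nbrs⁺ {C} {v} {w})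
  ... | y ∷ [] | nbr | mem = y , nbr (here refl) , λ vz → only (mem vz)
    where
    only : ∀ {z} → z ∈ y ∷ [] → z ≡ y
    only (here z≡y) = z≡y

  three-nbrs : ∀ C v → deg C v ≡ 3 → ∃ λ a → ∃₂ λ b c → (a ≢ b × a ≢ c × b ≢ c) ×
    (Nbr C v a × Nbr C v b × Nbr C v c) × (∀ {z} → Nbr C v z → z ≡ a ⊎ z ≡ b ⊎ z ≡ c)
  three-nbrs C v d≡3 with nbrs C v | nbrs-unique C v | (λ {w} → ∈-nbrs⁻ {C} {v} {w}) | (λ {w} → ∈-nbrs⁺ {C} {v} {w})
  ... | a ∷ b ∷ c ∷ [] | (a≢b ∷ a≢c ∷ []) ∷ (b≢c ∷ []) ∷ _ | nbr | mem =
    a , b , c , (a≢b , a≢c , b≢c) ,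
    (nbr (here refl) , nbr (there (here refl)) , nbr (there (there (here refl)))) , λ vz → among (mem vz)
    where
    among : ∀ {z} → z ∈ a ∷ b ∷ c ∷ [] → z ≡ a ⊎ z ≡ b ⊎ z ≡ c
    among (here z≡a)                 = inj₁ z≡a
    among (there (here z≡b))         = inj₂ (inj₁ z≡b)
    among (there (there (here z≡c))) = inj₂ (inj₂ z≡c)

  -- Removing one vertex from a vertex set

  infixl 7 _\\_
  _\\_ : (Fin n → Bool) → Fin n → Fin n → Bool
  (C \\ x) v = C v ∧ not (does (v ≟ x))

  \\⁺ : ∀ {C x v} → C v ≡ true → v ≢ x → (C \\ x) v ≡ true
  \\⁺ {C} {x} {v} Cv v≢x with v ≟ x
  ... | yes v≡x = contradiction v≡x v≢x
  ... | no  _   = trans (∧-identityʳ _) Cv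

  \\⁻ : ∀ {C x v} → (C \\ x) v ≡ true → C v ≡ true × v ≢ x
  \\⁻ {C} {x} {v} Cv with v ≟ x
  ... | yes _   = contradiction (trans (≡.sym Cv) (∧-zeroʳ (C v))) true≢false
  ... | no  v≢x = trans (≡.sym (∧-identityʳ _)) Cv , v≢x

  card-\\ : ∀ C x → C x ≡ true → card C ≡ card (C \\ x) + 1
  card-\\ C x Cx = trans (sum-cong-≗ split)
    (trans (∑-distrib-+ (λ i → ⟦ (C \\ x) i ⟧) (λ i → ⟦ does (i ≟ x) ⟧ * 1)) (cong (card (C \\ x) +_) (sum-δ x (λ _ → 1))))
    where
    split : ∀ i → ⟦ C i ⟧ ≡ ⟦ (C \\ x) i ⟧ + ⟦ does (i ≟ x) ⟧ * 1
    split i with i ≟ x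
    ... | yes refl rewrite Cx = refl
    ... | no  _ rewrite ∧-identityʳ (C i) = ≡.sym (+-identityʳ _)

  darts-\\ : ∀ C x → C x ≡ true → darts C ≡ darts (C \\ x) + (deg C x + deg C x)
  darts-\\ C x Cx = begin
    darts C
      ≡⟨ sum-cong-≗ (λ i → sum-cong-≗ (split i)) ⟩
    ∑[ i < n ] ∑[ j < n ] (a i j + (b i j + c i j))
      ≡⟨ ∑∑-distrib-+ a (λ i j → b i j + c i j) ⟩
    darts (C \\ x) + ∑[ i < n ] ∑[ j < n ] (b i j + c i j)
      ≡⟨ cong (darts (C \\ x) +_) (∑∑-distrib-+ b c) ⟩
    darts (C \\ x) + (∑[ i < n ] ∑[ j < n ] b i j + ∑[ i < n ] ∑[ j < n ] c i j)
      ≡⟨ cong (λ t → darts (C \\ x) + (t + ∑[ i < n ] ∑[ j < n ] c i j)) (∑-comm b) ⟩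
    darts (C \\ x) + (∑[ j < n ] ∑[ i < n ] b i j + ∑[ i < n ] ∑[ j < n ] c i j)
      ≡⟨ cong (darts (C \\ x) +_) (cong₂ _+_ pick pick) ⟩
    darts (C \\ x) + (deg C x + deg C x) ∎
    where
    open ≡-Reasoning
    h : Fin n → ℕ
    h j = ⟦ C j ∧ adj G x j ⟧
    a b c : Fin n → Fin n → ℕ
    a i j = ⟦ (C \\ x) i ∧ ((C \\ x) j ∧ adj G i j) ⟧
    b i j = ⟦ does (i ≟ x) ⟧ * h j
    c i j = ⟦ does (j ≟ x) ⟧ * h i
    ∑∑-distrib-+ : (p q : Fin n → Fin n → ℕ) →
      ∑[ i < n ] ∑[ j < n ] (p i j + q i j) ≡ ∑[ i < n ] ∑[ j < n ] p i j + ∑[ i < n ] ∑[ j < n ] q i j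
    ∑∑-distrib-+ p q = trans (sum-cong-≗ λ i → ∑-distrib-+ (p i) (q i)) (∑-distrib-+ (sum ∘ p) (sum ∘ q))
    pick : ∑[ i < n ] ∑[ j < n ] c i j ≡ deg C x
    pick = trans (sum-cong-≗ λ i → sum-δ x (λ _ → h i)) (≡.sym (deg≡∑ C x))
    -- An ordered pair avoids `x`, starts at `x` or ends at `x`. The last two cases overlap only in
    -- the pair of `x` with itself, which counts zero by irreflexivity.
    split : ∀ i j → ⟦ C i ∧ (C j ∧ adj G i j) ⟧ ≡ a i j + (b i j + c i j)
    split i j with i ≟ x | j ≟ x
    ... | yes refl | yes refl rewrite Cx | irrefl G x = refl
    ... | yes refl | no _ rewrite Cx | *-identityˡ (h j) = ≡.sym (+-identityʳ _)
    ... | no _ | yes refl rewrite Cx | ∧-zeroʳ (C i ∧ true) | Defs.sym G i x = ≡.sym (+-identityʳ _)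
    ... | no _ | no _ rewrite ∧-identityʳ (C i) | ∧-identityʳ (C j) = ≡.sym (+-identityʳ _)

  -- Pruning leaves down to the core

  data WalkIn (C : Fin n → Bool) : Fin n → Fin n → Set where
    here : ∀ {u} → WalkIn C u u
    step : ∀ {u v w} → Nbr C u v → WalkIn C v w → WalkIn C u w

  -- `Set`-valued, because the vertices with two escapes, to which it is applied below, are not
  -- given by a Boolean test.
  Dense : (Fin n → Set) → Set
  Dense P = ∀ x → P x → ∃₂ λ y z → y ≢ z × (P y × Adj G x y) × (P z × Adj G x z)

  -- Non-backtracking walks that enter C, with the vertex preceding the first one recorded.
  data Escape (C : Fin n → Bool) : Fin n → Fin n → Set where
    arrived : ∀ {p v} → C v ≡ true → Escape C p v
    onward  : ∀ {p v w} → Adj G v w → w ≢ p → Escape C v w → Escape C p v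

  -- The invariant of the pruning. `euler` says that edges minus vertices agree for the graph and
  -- for the subgraph induced on `C`, doubled and with the negative terms moved across; `escape`
  -- leads from every deleted vertex back to `C`.
  record Pruned (C : Fin n → Bool) : Set₁ where
    field
      euler     : darts C + 2 * n ≡ 2 * numEdges G + 2 * card C
      connected : ∀ {u v} → C u ≡ true → C v ≡ true → WalkIn C u v
      maximal   : ∀ {P} → Dense P → ∀ x → P x → C x ≡ true
      escape    : ∀ {v} → C v ≡ false → ∃ λ w → Adj G v w × Escape C v w
  open Pruned

  pruned-all : Connected G → Pruned (λ _ → true)
  pruned-all conn = record
    { euler     = cong₂ _+_ handshake (cong (2 *_) (≡.sym (sum-1 n)))
    ; connected = λ {u} {v} _ _ → walk (conn u v)
    ; maximal   = λ _ _ _ → refl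
    ; escape    = λ () }
    where
    walk : ∀ {u v} → Walk G u v → WalkIn (λ _ → true) u v
    walk here        = here
    walk (step uv p) = step (refl , uv) (walk p)

  module _ {C : Fin n → Bool} {x y : Fin n} (Cx : C x ≡ true) (xy : Nbr C x y)
           (only : ∀ {z} → Nbr C x z → z ≡ y) where

    leaf≢nbr : y ≢ x
    leaf≢nbr refl = true≢false (trans (≡.sym (proj₂ xy)) (irrefl G x))

    walk-\\ : ∀ {u v} → C u ≡ true → u ≢ x → v ≢ x → WalkIn C u v → WalkIn (C \\ x) u v
    walk-\\ Cu u≢x v≢x here = here
    walk-\\ Cu u≢x v≢x (step {v = a} (Ca , ua) p) with a ≟ x
    ... | no a≢x = step (\\⁺ {C} Ca a≢x , ua) (walk-\\ Ca a≢x v≢x p)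
    walk-\\ Cu u≢x v≢x (step (Ca , ua) here) | yes a≡x = contradiction a≡x v≢x
    walk-\\ Cu u≢x v≢x (step (Ca , ua) (step xb p)) | yes refl
      -- A walk that enters the leaf must return to the vertex it came from, so this detour of two
      -- steps is cut out.
      rewrite trans (only (Cu , adj-sym ua)) (≡.sym (only xb)) = walk-\\ (proj₁ xb) u≢x v≢x p

    escape-\\ : ∀ {p v} → C p ≡ false → Escape C p v → Escape (C \\ x) p v
    escape-\\ {p} {v} ¬Cp e with C v in eq
    escape-\\ {p} {v} ¬Cp e | true with v ≟ x
    -- The escape ended at the leaf being deleted, so it goes one step further to `y`. That is no
    -- backtracking, since `y` lies in `C` and `p` does not.
    ... | yes refl = onward (proj₂ xy) (λ { refl → true≢false (trans (≡.sym (proj₁ xy)) ¬Cp) })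
                            (arrived (\\⁺ {C} (proj₁ xy) leaf≢nbr))
    ... | no v≢x = arrived (\\⁺ {C} eq v≢x)
    escape-\\ ¬Cp (arrived Cv) | false = contradiction (trans (≡.sym Cv) eq) true≢false
    escape-\\ ¬Cp (onward vw w≢p e) | false = onward vw w≢p (escape-\\ eq e)

    -- One vertex and one edge, hence two darts, disappear, so both sides of `euler` drop by 2. A
    -- dense set lies in `C` and would give its members two distinct neighbours there, so it avoids
    -- the leaf.
    prune-leaf : deg C x ≡ 1 → Pruned C → Pruned (C \\ x)
    prune-leaf d≡1 P = record
      { euler     = euler′
      ; connected = λ Cu Cv → let Cu′ , u≢x = \\⁻ {C} Cu ; Cv′ , v≢x = \\⁻ {C} Cv in
                              walk-\\ Cu′ u≢x v≢x (connected P Cu′ Cv′)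
      ; maximal   = λ {Q} dense v Qv → \\⁺ {C} (maximal P dense v Qv) λ { refl → leaf∉ dense Qv }
      ; escape    = escape′ }
      where
      euler′ : darts (C \\ x) + 2 * n ≡ 2 * numEdges G + 2 * card (C \\ x)
      euler′ = +-cancelʳ-≡ 2 _ _ (begin
        darts (C \\ x) + 2 * n + 2
          ≡⟨ swap (darts (C \\ x)) (2 * n) ⟩
        darts (C \\ x) + (1 + 1) + 2 * n
          ≡⟨ cong (λ d → darts (C \\ x) + (d + d) + 2 * n) d≡1 ⟨
        darts (C \\ x) + (deg C x + deg C x) + 2 * n
          ≡⟨ cong (_+ 2 * n) (darts-\\ C x Cx) ⟨
        darts C + 2 * n
          ≡⟨ euler P ⟩
        2 * numEdges G + 2 * card C
          ≡⟨ cong (λ c → 2 * numEdges G + 2 * c) (card-\\ C x Cx) ⟩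
        2 * numEdges G + 2 * (card (C \\ x) + 1)
          ≡⟨ expand (2 * numEdges G) (card (C \\ x)) ⟩
        2 * numEdges G + 2 * card (C \\ x) + 2 ∎)
        where
        open ≡-Reasoning
        swap : ∀ a b → a + b + 2 ≡ a + 2 + b
        swap = solve-∀
        expand : ∀ a b → a + 2 * (b + 1) ≡ a + 2 * b + 2
        expand = solve-∀

      leaf∉ : ∀ {Q} → Dense Q → Q x → ⊥
      leaf∉ dense Qx with dense x Qx
      ... | a , b , a≢b , (Qa , xa) , (Qb , xb) =
        a≢b (trans (only (maximal P dense a Qa , xa)) (≡.sym (only (maximal P dense b Qb , xb))))

      escape′ : ∀ {v} → (C \\ x) v ≡ false → ∃ λ w → Adj G v w × Escape (C \\ x) v w
      escape′ {v} ¬C′v with C v in eq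
      ... | false = let w , vw , e = escape P eq in w , vw , escape-\\ eq e
      ... | true with v ≟ x
      ...   | yes refl = y , proj₂ xy , arrived (\\⁺ {C} (proj₁ xy) leaf≢nbr)
      ...   | no v≢x   = contradiction ¬C′v true≢false

  -- The bound `m` on the cardinality is fuel: each deletion uses up one unit. Vertices of degree 0
  -- are left alone here and excluded in `deg≥2`.
  prune : ∀ m C → card C ≤ m → Pruned C →
    Σ (Fin n → Bool) λ C′ → Pruned C′ × (∀ v → C′ v ≡ true → deg C′ v ≢ 1)
  prune m C c≤m P with any? (λ v → (C v Bool.≟ true) ×-dec (deg C v ℕ.≟ 1))
  ... | no none = C , P , λ v Cv d≡1 → none (v , Cv , d≡1)
  prune zero C c≤0 P | yes (v , Cv , d≡1) =
    contradiction (≤-trans (≤-reflexive (trans (+-comm 1 _) (≡.sym (card-\\ C v Cv)))) c≤0) λ ()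
  prune (suc m) C c≤m P | yes (v , Cv , d≡1)
    = let y , vy , only = one-nbr C v d≡1 in
      prune m (C \\ v) (s≤s⁻¹ (≤-trans (≤-reflexive (trans (+-comm 1 _) (≡.sym (card-\\ C v Cv)))) c≤m))
        (prune-leaf Cv vy only d≡1 P)

  -- Automorphisms and orbits of vertex stabilisers

  flip-aut : ∀ {π} → IsAut G π → IsAut G (Perm.flip π)
  flip-aut {π} aut i j = trans (≡.sym (aut _ _)) (cong₂ (adj G) (Perm.inverseʳ π) (Perm.inverseʳ π))

  flip-fix : ∀ (π : Permutation′ n) {i j} → π ⟨$⟩ʳ i ≡ j → π ⟨$⟩ˡ j ≡ i
  flip-fix π refl = Perm.inverseˡ π

  perm-injective : ∀ (π : Permutation′ n) {i j} → π ⟨$⟩ʳ i ≡ π ⟨$⟩ʳ j → i ≡ j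
  perm-injective π eq = trans (≡.sym (flip-fix π eq)) (Perm.inverseˡ π)

  orbit-refl : ∀ {v w} → InStabOrbit G v w w
  orbit-refl = Perm.id , (λ _ _ → refl) , refl , refl

  orbit-sym : ∀ {v a b} → InStabOrbit G v a b → InStabOrbit G v b a
  orbit-sym (π , aut , fix , πa) = Perm.flip π , flip-aut {π} aut , flip-fix π fix , flip-fix π πa

  orbit-trans : ∀ {v a b c} → InStabOrbit G v a b → InStabOrbit G v b c → InStabOrbit G v a c
  orbit-trans (π , aut , fix , refl) (ρ , aut′ , fix′ , refl) =
    π ∘ₚ ρ , (λ i j → trans (aut′ _ _) (aut i j)) , trans (cong (ρ ⟨$⟩ʳ_) fix) fix′ , refl

  pivot-orbit-not-singleton : ∀ {v w} → IsPivot G v → Adj G v w → ¬ (∀ u → InStabOrbit G v w u → u ≡ w)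
  pivot-orbit-not-singleton {v} {w} piv vw single =
    from-no (2 ∣? 1) (piv w vw 1 ((λ _ → w) , inj , (λ _ → orbit-refl) , λ u o → zero , ≡.sym (single u o)))
    where
    inj : Injective _≡_ _≡_ (λ (_ : Fin 1) → w)
    inj {zero} {zero} _ = refl

  -- If every automorphism fixing `v` also fixed `w`, the orbit of `w` would have the odd size 1.
  -- This refutes but constructs no automorphism, whence the double negation.
  pivot-moves-nbr : ∀ {v w} → IsPivot G v → Adj G v w →
    ¬ ¬ (Σ (Permutation′ n) λ π → IsAut G π × π ⟨$⟩ʳ v ≡ v × π ⟨$⟩ʳ w ≢ w)
  pivot-moves-nbr {v} {w} piv vw none = pivot-orbit-not-singleton piv vw single
    where
    single : ∀ u → InStabOrbit G v w u → u ≡ w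
    single u (π , aut , fix , refl) = decidable-stable (_ ≟ w) λ moved → none (π , aut , fix , moved)

  -- Invariance of the core and the position of pivots in it

  module Core {C : Fin n → Bool} (P : Pruned C) (C-dense : Dense (λ v → C v ≡ true)) where

    -- The preimage of `C` under an automorphism is again dense, so maximality puts it inside `C`.
    aut-reflects-C : ∀ {π} → IsAut G π → ∀ {v} → C (π ⟨$⟩ʳ v) ≡ true → C v ≡ true
    aut-reflects-C {π} aut {v} = maximal P dense v
      where
      dense : Dense (λ v → C (π ⟨$⟩ʳ v) ≡ true)
      dense v Cπv with C-dense _ Cπv
      ... | y , z , y≢z , (Cy , vy) , (Cz , vz) =
        π ⟨$⟩ˡ y , π ⟨$⟩ˡ z , y≢z ∘ perm-injective (Perm.flip π) , pull Cy vy , pull Cz vz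
        where
        pull : ∀ {y} → C y ≡ true → Adj G (π ⟨$⟩ʳ v) y → C (π ⟨$⟩ʳ (π ⟨$⟩ˡ y)) ≡ true × Adj G v (π ⟨$⟩ˡ y)
        pull {y} Cy vy = trans (cong C (Perm.inverseʳ π)) Cy ,
          trans (≡.sym (aut _ _)) (trans (cong (adj G _) (Perm.inverseʳ π)) vy)

    aut-C : ∀ {π} → IsAut G π → ∀ v → C (π ⟨$⟩ʳ v) ≡ C v
    aut-C {π} aut v with C v in Cv
    ... | true  = aut-reflects-C {Perm.flip π} (flip-aut {π} aut) (trans (cong C (Perm.inverseˡ π)) Cv)
    ... | false with C (π ⟨$⟩ʳ v) in Cπv
    ...   | false = refl
    ...   | true  = trans (≡.sym (aut-reflects-C {π} aut Cπv)) Cv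

    aut-nbr : ∀ {π} → IsAut G π → ∀ {v w} → Nbr C v w → Nbr C (π ⟨$⟩ʳ v) (π ⟨$⟩ʳ w)
    aut-nbr {π} aut (Cw , vw) = trans (aut-C {π} aut _) Cw , trans (aut _ _) vw

    aut-deg : ∀ {π} → IsAut G π → ∀ v → deg C (π ⟨$⟩ʳ v) ≡ deg C v
    aut-deg {π} aut v = begin
      deg C (π ⟨$⟩ʳ v)
        ≡⟨ deg≡∑ C (π ⟨$⟩ʳ v) ⟩
      ∑[ w < n ] ⟦ C w ∧ adj G (π ⟨$⟩ʳ v) w ⟧
        ≡⟨ ∑-permute (λ w → ⟦ C w ∧ adj G (π ⟨$⟩ʳ v) w ⟧) π ⟩
      ∑[ w < n ] ⟦ C (π ⟨$⟩ʳ w) ∧ adj G (π ⟨$⟩ʳ v) (π ⟨$⟩ʳ w) ⟧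
        ≡⟨ sum-cong-≗ (λ w → cong ⟦_⟧ (cong₂ _∧_ (aut-C {π} aut w) (aut v w))) ⟩
      ∑[ w < n ] ⟦ C w ∧ adj G v w ⟧
        ≡⟨ deg≡∑ C v ⟨
      deg C v ∎
      where open ≡-Reasoning

    aut-escape : ∀ {π} → IsAut G π → ∀ {p v} → Escape C p v → Escape C (π ⟨$⟩ʳ p) (π ⟨$⟩ʳ v)
    aut-escape {π} aut (arrived Cv)      = arrived (trans (aut-C {π} aut _) Cv)
    aut-escape {π} aut (onward vw w≢p e) =
      onward (trans (aut _ _) vw) (w≢p ∘ perm-injective π) (aut-escape {π} aut e)

    -- The vertices with two distinct ways out form, together with C, a dense set.
    two-escapes⇒C : ∀ {v y z} → y ≢ z → Adj G v y → Adj G v z → Escape C v y → Escape C v z → C v ≡ true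
    two-escapes⇒C {v} y≢z vy vz ey ez = maximal P dense v (inj₂ (_ , _ , y≢z , (vy , ey) , (vz , ez)))
      where
      Q : Fin n → Set
      Q v = C v ≡ true ⊎ (∃₂ λ y z → y ≢ z × (Adj G v y × Escape C v y) × (Adj G v z × Escape C v z))
      next-Q : ∀ {x y z} → y ≢ z → Adj G x y → Escape C x y → Adj G x z → Escape C x z → Q y
      next-Q y≢z xy (arrived Cy) xz ez = inj₁ Cy
      -- From `y` one way out continues the given escape; the other steps back to `x` and follows
      -- the second escape through `z`.
      next-Q y≢z xy (onward {w = w} yw w≢x ew) xz ez =
        inj₂ (w , _ , w≢x , (yw , ew) , (adj-sym xy , onward xz (y≢z ∘ ≡.sym) ez))
      dense : Dense Q
      dense x (inj₁ Cx) with C-dense x Cx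
      ... | y , z , y≢z , (Cy , xy) , (Cz , xz) = y , z , y≢z , (inj₁ Cy , xy) , (inj₁ Cz , xz)
      dense x (inj₂ (y , z , y≢z , (xy , ey) , (xz , ez))) =
        y , z , y≢z , (next-Q y≢z xy ey xz ez , xy) , (next-Q (y≢z ∘ ≡.sym) xz ez xy ey , xz)

    -- Outside `C`, an automorphism fixing `v` and moving the first vertex of an escape would
    -- produce a second escape with a different first vertex.
    pivot⇒C : ∀ {v} → IsPivot G v → C v ≡ true
    pivot⇒C {v} piv with C v in Cv
    ... | true  = refl
    ... | false with escape P Cv
    ...   | w , vw , e = ⊥-elim (pivot-moves-nbr piv vw λ { (π , aut , fix , moved) →
      true≢false (trans (≡.sym (two-escapes⇒C (moved ∘ ≡.sym) vw
        (subst (λ t → Adj G t (π ⟨$⟩ʳ w)) fix (trans (aut _ _) vw)) e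
        (subst (λ t → Escape C t (π ⟨$⟩ʳ w)) fix (aut-escape {π} aut e)))) Cv) })

    orbit-nbr : ∀ {v w u} → Nbr C v w → InStabOrbit G v w u → Nbr C v u
    orbit-nbr {w = w} vw (π , aut , fix , refl) =
      subst (λ t → Nbr C t (π ⟨$⟩ʳ w)) fix (aut-nbr {π} aut vw)

    -- The orbits of the three core neighbours stay among them. If the orbit of `a` contains all
    -- three, it is odd; if it is only `a`, likewise; if it omits exactly one of `b` and `c`, the
    -- omitted one is an orbit by itself.
    pivot-deg≢3 : ∀ {v} → IsPivot G v → deg C v ≢ 3
    pivot-deg≢3 {v} piv d≡3 with three-nbrs C v d≡3
    ... | a , b , c , (a≢b , a≢c , b≢c) , (va , vb , vc) , among =
      -- Orbit membership comes with no decision procedure, but the goal is `⊥`, so its cases may be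
      -- distinguished.
      ¬¬-excluded-middle λ ab? → ¬¬-excluded-middle λ ac? → cases ab? ac?
      where
      O : Fin n → Fin n → Set
      O = InStabOrbit G v

      three : O a b → O a c → ⊥
      three ab ac = from-no (2 ∣? 3) (piv a (proj₂ va) 3 (f , inj , in-orbit , all))
        where
        f : Fin 3 → Fin n
        f zero             = a
        f (suc zero)       = b
        f (suc (suc zero)) = c
        inj : Injective _≡_ _≡_ f
        inj {zero}           {zero}           _  = refl
        inj {zero}           {suc zero}       eq = contradiction eq a≢b
        inj {zero}           {suc (suc zero)} eq = contradiction eq a≢c
        inj {suc zero}       {zero}           eq = contradiction (≡.sym eq) a≢b
        inj {suc zero}       {suc zero}       _  = refl
        inj {suc zero}       {suc (suc zero)} eq = contradiction eq b≢c
        inj {suc (suc zero)} {zero}           eq = contradiction (≡.sym eq) a≢c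
        inj {suc (suc zero)} {suc zero}       eq = contradiction (≡.sym eq) b≢c
        inj {suc (suc zero)} {suc (suc zero)} _  = refl
        in-orbit : ∀ i → O a (f i)
        in-orbit zero             = orbit-refl
        in-orbit (suc zero)       = ab
        in-orbit (suc (suc zero)) = ac
        all : ∀ u → O a u → ∃[ i ] f i ≡ u
        all u o with among (orbit-nbr va o)
        ... | inj₁ refl        = zero , refl
        ... | inj₂ (inj₁ refl) = suc zero , refl
        ... | inj₂ (inj₂ refl) = suc (suc zero) , refl

      isolated : ∀ {x} → Nbr C v x → (O x a → x ≡ a) → (O x b → x ≡ b) → (O x c → x ≡ c) → ⊥
      isolated {x} vx xa xb xc = pivot-orbit-not-singleton piv (proj₂ vx) single
        where
        single : ∀ u → O x u → u ≡ x
        single u o with among (orbit-nbr vx o)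
        ... | inj₁ refl        = ≡.sym (xa o)
        ... | inj₂ (inj₁ refl) = ≡.sym (xb o)
        ... | inj₂ (inj₂ refl) = ≡.sym (xc o)

      cases : Dec (O a b) → Dec (O a c) → ⊥
      cases (yes ab) (yes ac) = three ab ac
      cases (no ¬ab) (no ¬ac) =
        isolated va (λ _ → refl) (λ o → contradiction o ¬ab) (λ o → contradiction o ¬ac)
      cases (yes ab) (no ¬ac) =
        isolated vc (λ o → contradiction (orbit-sym o) ¬ac)
          (λ o → contradiction (orbit-trans ab (orbit-sym o)) ¬ac) (λ _ → refl)
      cases (no ¬ab) (yes ac) =
        isolated vb (λ o → contradiction (orbit-sym o) ¬ab) (λ _ → refl)
          (λ o → contradiction (orbit-trans ac (orbit-sym o)) ¬ab)

    -- Rays of thin vertices leaving a branch vertex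

    -- Ray b x i u v: leaving the branch vertex b through x and passing straight
    -- through vertices of degree at most two, the edge after i of these is u v.
    data Ray (b x : Fin n) : ℕ → Fin n → Fin n → Set where
      start : C b ≡ true → 3 ≤ deg C b → Nbr C b x → Ray b x 0 b x
      next  : ∀ {i u v w} → Ray b x i u v → deg C v ≤ 2 → Nbr C v w → w ≢ u → Ray b x (suc i) v w

    ray-edge : ∀ {b x i u v} → Ray b x i u v → C u ≡ true × Nbr C u v
    ray-edge (start Cb _ bx) = Cb , bx
    ray-edge (next r _ vw _) = proj₁ (proj₂ (ray-edge r)) , vw

    ray-back : ∀ {b x i u v} → Ray b x i u v → Nbr C v u
    ray-back r = let Cu , _ , uv = ray-edge r in Cu , adj-sym uv

    -- A vertex of degree at most two has at most one core neighbour besides the one just left, so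
    -- the first edge and the number of steps fix the rest.
    ray-deterministic : ∀ {b x i u v u′ v′} → Ray b x i u v → Ray b x i u′ v′ → u ≡ u′ × v ≡ v′
    ray-deterministic (start _ _ _) (start _ _ _) = refl , refl
    ray-deterministic (next {v = v} r d vw w≢u) (next r′ _ vw′ w′≢u) with ray-deterministic r r′
    ... | refl , refl = refl , at-most-two (nbrs C v) d (∈-nbrs⁺ {C} (ray-back r)) (∈-nbrs⁺ {C} vw)
                                 (∈-nbrs⁺ {C} vw′) (w≢u ∘ ≡.sym) (w′≢u ∘ ≡.sym)

    ray-prefix : ∀ {b x i u v m} → Ray b x i u v → m < i → ∃₂ λ p q → Ray b x m p q × deg C q ≤ 2
    ray-prefix {m = m} (next {i = i} r d _ _) (s≤s m≤i) with m ℕ.≟ i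
    ... | yes refl = _ , _ , r , d
    ... | no m≢i   = ray-prefix r (≤∧≢⇒< m≤i m≢i)

    -- A longer ray would, by determinism, pass through `q`, but it may only pass vertices of degree
    -- at most two.
    ray-bounded : ∀ {b x m p q i u v} → Ray b x m p q → 3 ≤ deg C q → Ray b x i u v → i ≤ m
    ray-bounded {m = m} {i = i} r thick r′ with i ≤? m
    ... | yes i≤m = i≤m
    ... | no  i≰m with ray-prefix r′ (≰⇒> i≰m)
    ...   | p , q , r″ , thin with ray-deterministic r r″
    ...     | refl , refl = contradiction (≤-trans thick thin) λ { (s≤s (s≤s ())) }

    -- Two rays meeting at `v` from different sides: prolong the first along the second reversed
    -- until it hits the branch vertex `b′`. The second has `suc j` edges, whence the index. The
    -- recursion moves one edge at a time from the second ray to the first.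
    ray-join : ∀ {b x i u v b′ x′ j u′} → Ray b x i u v → Ray b′ x′ j u′ v → u ≢ u′ → deg C v ≤ 2 →
      ∃₂ λ p q → Ray b x (i + suc j) p q × 3 ≤ deg C q
    ray-join {b} {x} {i} {v = v} {b′ = b′} r r′@(start _ thick _) u≢u′ d =
      _ , _ , subst (λ m → Ray b x m v b′) (+-comm 1 i) (next r d (ray-back r′) (u≢u′ ∘ ≡.sym)) , thick
    ray-join {b} {x} {i} {j = suc j} r r′@(next s d′ _ v≢w) u≢u′ d
      with ray-join (next r d (ray-back r′) (u≢u′ ∘ ≡.sym)) s v≢w d′
    ... | p , q , t , thick = p , q , subst (λ m → Ray b x m p q) (≡.sym (+-suc i (suc j))) t , thick

    aut-ray : ∀ {π} → IsAut G π → ∀ {b x i u v} → Ray b x i u v →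
      Ray (π ⟨$⟩ʳ b) (π ⟨$⟩ʳ x) i (π ⟨$⟩ʳ u) (π ⟨$⟩ʳ v)
    aut-ray {π} aut (start Cb thick bx) = start (trans (aut-C {π} aut _) Cb)
      (≤-trans thick (≤-reflexive (≡.sym (aut-deg {π} aut _)))) (aut-nbr {π} aut bx)
    aut-ray {π} aut (next r d vw w≢u) = next (aut-ray {π} aut r)
      (≤-trans (≤-reflexive (aut-deg {π} aut _)) d) (aut-nbr {π} aut vw) (w≢u ∘ perm-injective π)

    -- Charging pivots to branch vertices

    Reached : Fin n → Set
    Reached v = 3 ≤ deg C v ⊎ (∃ λ b → ∃ λ x → ∃ λ i → ∃ λ u → Ray b x i u v)

    -- Along the walk, a step from a branch vertex starts a ray; a step from a thin vertex either
    -- prolongs the ray or retreats along it.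
    walk-reached : ∀ {u v} → C u ≡ true → Reached u → WalkIn C u v → Reached v
    walk-reached Cu ru here = ru
    walk-reached {u} Cu ru (step {v = w} uw p) = walk-reached (proj₁ uw) (extend ru) p
      where
      extend : Reached u → Reached w
      extend ru with 3 ≤? deg C u
      extend _ | yes thick = inj₂ (_ , _ , _ , _ , start Cu thick uw)
      extend (inj₁ thick) | no ¬thick = contradiction thick ¬thick
      extend (inj₂ (b , x , i , t , r)) | no ¬thick with w ≟ t
      ... | no w≢t = inj₂ (_ , _ , _ , _ , next r (s≤s⁻¹ (≰⇒> ¬thick)) uw w≢t)
      extend (inj₂ (b , x , _ , _ , start _ thick _)) | no _ | yes refl = inj₁ thick
      extend (inj₂ (b , x , _ , _ , next r _ _ _))    | no _ | yes refl = inj₂ (_ , _ , _ , _ , r)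

    -- The common index `i` of the two rays makes `v` a midpoint. The ends may coincide, when the
    -- path closes up at a single branch vertex.
    data Charge (v : Fin n) : Set where
      edge-midpoint : ∀ {i} (b x u : Fin 2 → Fin n) → (∀ s → Ray (b s) (x s) i (u s) v) →
                      u zero ≢ u (suc zero) → deg C v ≤ 2 → Charge v
      branch-vertex : C v ≡ true → 4 ≤ deg C v → Charge v

    -- For a thin pivot, an automorphism fixing `v` and moving `u` carries the ray to one of the
    -- same length that arrives from another neighbour.
    pivot-charge : ∀ {b₀} → C b₀ ≡ true → 3 ≤ deg C b₀ → ∀ {v} → IsPivot G v → ¬ ¬ Charge v
    pivot-charge {b₀} Cb₀ thick₀ {v} piv none with 3 ≤? deg C v
    ... | yes thick = none (branch-vertex (pivot⇒C piv) (≤∧≢⇒< thick (pivot-deg≢3 piv ∘ ≡.sym)))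
    ... | no ¬thick with walk-reached Cb₀ (inj₁ thick₀) (connected P Cb₀ (pivot⇒C piv))
    ...   | inj₁ thick = ¬thick thick
    ...   | inj₂ (b , x , i , u , r) = pivot-moves-nbr piv (proj₂ (ray-back r)) reflect
      where
      reflect : ¬ (Σ (Permutation′ n) λ π → IsAut G π × π ⟨$⟩ʳ v ≡ v × π ⟨$⟩ʳ u ≢ u)
      reflect (π , aut , fix , moved) = none (edge-midpoint (pair b) (pair x) (pair u) rays
                                               (moved ∘ ≡.sym) (s≤s⁻¹ (≰⇒> ¬thick)))
        where
        pair : Fin n → Fin 2 → Fin n
        pair t zero       = t
        pair t (suc zero) = π ⟨$⟩ʳ t
        rays : ∀ s → Ray (pair b s) (pair x s) i (pair u s) v
        rays zero       = r
        rays (suc zero) = subst (Ray _ _ i _) fix (aut-ray {π} aut r)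

    -- `inj₁` names a directed edge by its head, `inj₂` one of the two extra units of a vertex of
    -- degree at least four.
    Token : Set
    Token = Fin n × (Fin n ⊎ Fin 2)

    token : ∀ {v} → Charge v → Fin 2 → Token
    token (edge-midpoint b x _ _ _ _) s = b s , inj₁ (x s)
    token {v} (branch-vertex _ _)     s = v , inj₂ s

    -- Joining the two halves, the path between branch vertices has its last edge at index
    -- `i + suc i`; this is how a directed edge determines `i`.
    dart-length : ∀ {b x u : Fin 2 → Fin n} {i v} → (∀ s → Ray (b s) (x s) i (u s) v) →
      u zero ≢ u (suc zero) → deg C v ≤ 2 → ∀ s → ∃₂ λ p q → Ray (b s) (x s) (i + suc i) p q × 3 ≤ deg C q
    dart-length r u≢ d zero       = ray-join (r zero) (r (suc zero)) u≢ d
    dart-length r u≢ d (suc zero) = ray-join (r (suc zero)) (r zero) (u≢ ∘ ≡.sym) d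

    i+1+i≤⇒≤ : ∀ {i j} → i + suc i ≤ j + suc j → i ≤ j
    i+1+i≤⇒≤ {i} {j} le with i ≤? j
    ... | yes i≤j = i≤j
    ... | no  i≰j = contradiction (+-mono-< (≰⇒> i≰j) (s≤s (≰⇒> i≰j))) (≤⇒≯ le)

    -- Equal directed edges start the same ray, which first meets a branch vertex at a fixed index.
    -- Hence both midpoints have the same `i`, and determinism identifies them.
    token-injectiveˡ : ∀ {v v′} (c : Charge v) (c′ : Charge v′) {s s′} → token c s ≡ token c′ s′ → v ≡ v′
    token-injectiveˡ (branch-vertex _ _) (branch-vertex _ _) refl = refl
    token-injectiveˡ (edge-midpoint {i} b x u r u≢ d) (edge-midpoint {j} b′ x′ u′ r′ u′≢ d′) {s} {s′} eq
      with b s | x s | r s | dart-length r u≢ d s | b′ s′ | x′ s′ | r′ s′ | dart-length r′ u′≢ d′ s′ | eq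
    ... | _ | _ | rs | _ , _ , R , t | _ | _ | rs′ | _ , _ , R′ , t′ | refl
      with ≤-antisym (i+1+i≤⇒≤ {i} {j} (ray-bounded R′ t′ R)) (i+1+i≤⇒≤ {j} {i} (ray-bounded R t R′))
    ... | refl = proj₂ (ray-deterministic rs rs′)

    -- Were the two starting edges equal, determinism would make both rays reach `v` from the same
    -- neighbour.
    darts-distinct : ∀ (b x u : Fin 2 → Fin n) {i v} → (∀ s → Ray (b s) (x s) i (u s) v) →
      u zero ≢ u (suc zero) → (b zero , inj₁ (x zero)) ≢ (Token ∋ (b (suc zero) , inj₁ (x (suc zero))))
    darts-distinct b x u r u≢ eq with b zero | x zero | b (suc zero) | x (suc zero) | r zero | r (suc zero) | eq
    ... | _ | _ | _ | _ | r₀ | r₁ | refl = u≢ (proj₁ (ray-deterministic r₀ r₁))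

    token-injectiveʳ : ∀ {v} (c : Charge v) {s s′} → token c s ≡ token c s′ → s ≡ s′
    token-injectiveʳ (branch-vertex _ _) refl = refl
    token-injectiveʳ (edge-midpoint b x u r u≢ d) {zero}     {zero}     eq = refl
    token-injectiveʳ (edge-midpoint b x u r u≢ d) {suc zero} {suc zero} eq = refl
    token-injectiveʳ (edge-midpoint b x u r u≢ d) {zero}     {suc zero} eq =
      contradiction eq (darts-distinct b x u r u≢)
    token-injectiveʳ (edge-midpoint b x u r u≢ d) {suc zero} {zero}     eq =
      contradiction (≡.sym eq) (darts-distinct b x u r u≢)

    -- Counting the tokens at each vertex

    -- The Boolean and the decisions are arguments so that later proofs can split on them directly.
    tokensIf : ∀ v → Bool → Dec (3 ≤ deg C v) → Dec (4 ≤ deg C v) → List Token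
    tokensIf v true (yes _) (yes _) = map (λ w → v , inj₁ w) (nbrs C v) ++ map (λ s → v , inj₂ s) (allFin 2)
    tokensIf v true (yes _) (no _)  = map (λ w → v , inj₁ w) (nbrs C v)
    tokensIf v _    _       _       = []

    tokensAt : Fin n → List Token
    tokensAt v = tokensIf v (C v) (3 ≤? deg C v) (4 ≤? deg C v)

    dart∈ : ∀ {v w c} → c ≡ true → 3 ≤ deg C v → Nbr C v w → ∀ d₃ d₄ → (v , inj₁ w) ∈ tokensIf v c d₃ d₄
    dart∈ refl thick vw (yes _)     (yes _) = ∈-++⁺ˡ (∈-map⁺ _ (∈-nbrs⁺ {C} vw))
    dart∈ refl thick vw (yes _)     (no _)  = ∈-map⁺ _ (∈-nbrs⁺ {C} vw)
    dart∈ refl thick vw (no ¬thick) _       = contradiction thick ¬thick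

    branch∈ : ∀ {v c} → c ≡ true → 4 ≤ deg C v → ∀ s d₃ d₄ → (v , inj₂ s) ∈ tokensIf v c d₃ d₄
    branch∈ {v} refl 4≤d s (yes _) (yes _)  = ∈-++⁺ʳ (map (λ w → v , inj₁ w) (nbrs C v)) (∈-map⁺ (λ s → v , inj₂ s) (∈-allFin s))
    branch∈ refl 4≤d s (yes _)     (no 4≰d) = contradiction 4≤d 4≰d
    branch∈ refl 4≤d s (no ¬thick) _        = contradiction (<⇒≤ 4≤d) ¬thick

    token∈tokensAt : ∀ {v} (c : Charge v) s → token c s ∈ tokensAt (proj₁ (token c s))
    token∈tokensAt (edge-midpoint b x _ r _ _) s = first-dart (r s)
      where
      first-dart : ∀ {b x i u v} → Ray b x i u v → (b , inj₁ x) ∈ tokensAt b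
      first-dart (start Cb thick bx) = dart∈ Cb thick bx _ _
      first-dart (next r _ _ _)      = first-dart r
    token∈tokensAt (branch-vertex Cv 4≤d) s = branch∈ Cv 4≤d s _ _

    token∈ : ∀ {v} (c : Charge v) s → token c s ∈ concatMap tokensAt (allFin n)
    token∈ c s = ∈-concatMap⁺ tokensAt (lose (∈-allFin (proj₁ (token c s))) (token∈tokensAt c s))

    -- With `d` the degree in `C`, the bound 3(d - 2) is written without subtraction. For d = 2
    -- nothing is paid; d ≥ 3 gives 6 ≤ 2d, and d ≥ 4 gives 2 + 6 ≤ 2d.
    length-tokensIf : ∀ v c d₃ d₄ → (c ≡ true → 2 ≤ deg C v) →
      length (tokensIf v c d₃ d₄) + 6 * ⟦ c ⟧ ≤ 3 * (⟦ c ⟧ * deg C v)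
    length-tokensIf v false _ _ _ = z≤n
    length-tokensIf v true (no _) _ 2≤d =
      *-monoʳ-≤ 3 (≤-trans (2≤d refl) (≤-reflexive (≡.sym (*-identityˡ (deg C v)))))
    length-tokensIf v true (yes 3≤d) (no _) _ = begin
      length (map (λ w → Token ∋ (v , inj₁ w)) (nbrs C v)) + 6   ≡⟨ cong (_+ 6) (length-map _ (nbrs C v)) ⟩
      deg C v + 2 * 3                                            ≤⟨ +-monoʳ-≤ (deg C v) (*-monoʳ-≤ 2 3≤d) ⟩
      deg C v + 2 * deg C v                                      ≡⟨ cong (3 *_) (*-identityˡ (deg C v)) ⟨
      3 * (1 * deg C v)                                          ∎
      where open ≤-Reasoning
    length-tokensIf v true (yes 3≤d) (yes 4≤d) _ = begin
      length (map (λ w → Token ∋ (v , inj₁ w)) (nbrs C v) ++ _) + 6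
        ≡⟨ cong (_+ 6) (length-++ (map (λ w → Token ∋ (v , inj₁ w)) (nbrs C v))) ⟩
      length (map (λ w → Token ∋ (v , inj₁ w)) (nbrs C v)) + 2 + 6
        ≡⟨ cong (λ d → d + 2 + 6) (length-map _ (nbrs C v)) ⟩
      deg C v + 2 + 6         ≡⟨ +-assoc (deg C v) 2 6 ⟩
      deg C v + 2 * 4         ≤⟨ +-monoʳ-≤ (deg C v) (*-monoʳ-≤ 2 4≤d) ⟩
      deg C v + 2 * deg C v   ≡⟨ cong (3 *_) (*-identityˡ (deg C v)) ⟨
      3 * (1 * deg C v)       ∎
      where open ≤-Reasoning

    -- `Fin (k * 2)` codes pairs of a charged vertex and one of its two tokens; these embed into the
    -- list of all tokens, whose length is estimated vertex by vertex.
    charge-bound : (∀ v → C v ≡ true → 2 ≤ deg C v) → ∀ {k} (f : Fin k → Fin n) →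
      Injective _≡_ _≡_ f → (∀ a → Charge (f a)) → k * 2 + 6 * card C ≤ 3 * darts C
    charge-bound 2≤d {k} f inj charge = begin
      k * 2 + 6 * card C
        ≤⟨ +-monoˡ-≤ (6 * card C) (injective-into-list (uncurry tok ∘ remQuot 2) tok-inj (λ i → uncurry tok∈ (remQuot 2 i))) ⟩
      length (concatMap tokensAt (allFin n)) + 6 * card C
        ≡⟨ cong₂ _+_ (length-concatMap tokensAt (λ v → v)) (*-distribˡ-sum 6 (λ v → ⟦ C v ⟧)) ⟩
      ∑[ v < n ] length (tokensAt v) + ∑[ v < n ] (6 * ⟦ C v ⟧)
        ≡⟨ ∑-distrib-+ (λ v → length (tokensAt v)) (λ v → 6 * ⟦ C v ⟧) ⟨
      ∑[ v < n ] (length (tokensAt v) + 6 * ⟦ C v ⟧)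
        ≤⟨ sum-mono (λ v → length-tokensIf v (C v) _ _ (2≤d v)) ⟩
      ∑[ v < n ] (3 * (⟦ C v ⟧ * deg C v))
        ≡⟨ *-distribˡ-sum 3 (λ v → ⟦ C v ⟧ * deg C v) ⟨
      3 * ∑[ v < n ] (⟦ C v ⟧ * deg C v)
        ≡⟨ cong (3 *_) (darts≡∑ C) ⟨
      3 * darts C ∎
      where
      open ≤-Reasoning
      tok : Fin k → Fin 2 → Token
      tok a = token (charge a)
      tok∈ : ∀ a s → tok a s ∈ concatMap tokensAt (allFin n)
      tok∈ a = token∈ (charge a)
      tok-inj₂ : ∀ a s a′ s′ → tok a s ≡ tok a′ s′ → (a , s) ≡ (a′ , s′)
      tok-inj₂ a s a′ s′ eq with inj (token-injectiveˡ (charge a) (charge a′) eq)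
      ... | refl = cong (a ,_) (token-injectiveʳ (charge a) eq)
      tok-inj : Injective _≡_ _≡_ (uncurry tok ∘ remQuot {k} 2)
      tok-inj {i} {j} eq = trans (≡.sym (combine-remQuot {k} 2 i))
        (trans (cong (uncurry combine) (tok-inj₂ _ _ _ _ eq)) (combine-remQuot {k} 2 j))

  -- Branch vertices exist, and the final count

  -- With more edges than vertices, `euler` makes the average degree in `C` exceed two.
  branch-vertex-exists : ∀ {C} → Pruned C → n + 1 ≤ numEdges G → ∃ λ b → C b ≡ true × 3 ≤ deg C b
  branch-vertex-exists {C} P n<E with any? (λ v → (C v Bool.≟ true) ×-dec (3 ≤? deg C v))
  ... | yes b   = b
  ... | no none = contradiction darts≤ (<⇒≱ <darts)
    where
    thin : ∀ v → ⟦ C v ⟧ * deg C v ≤ 2 * ⟦ C v ⟧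
    thin v with C v in Cv
    ... | false = z≤n
    ... | true  = ≤-trans (≤-reflexive (*-identityˡ _)) (s≤s⁻¹ (≰⇒> λ thick → none (v , Cv , thick)))
    darts≤ : darts C ≤ 2 * card C
    darts≤ = ≤-trans (≤-reflexive (darts≡∑ C))
      (≤-trans (sum-mono thin) (≤-reflexive (≡.sym (*-distribˡ-sum 2 (λ v → ⟦ C v ⟧)))))
    <darts : 2 * card C < darts C
    <darts = +-cancelʳ-< (2 * n) _ _ (begin-strict
      2 * card C + 2 * n              ≡⟨ +-comm (2 * card C) (2 * n) ⟩
      2 * n + 2 * card C              <⟨ +-monoˡ-< (2 * card C) (*-monoʳ-< 2 (≤-trans (≤-reflexive (+-comm 1 n)) n<E)) ⟩
      2 * numEdges G + 2 * card C     ≡⟨ euler P ⟨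
      darts C + 2 * n                 ∎)
      where open ≤-Reasoning

  -- The walk to `b` inside `C` rules out degree 0: it has a first step, or else `v` is `b` itself.
  deg≥2 : ∀ {C b} → Pruned C → (∀ v → C v ≡ true → deg C v ≢ 1) → C b ≡ true → 3 ≤ deg C b →
    ∀ v → C v ≡ true → 2 ≤ deg C v
  deg≥2 {C} {b} P no-leaf Cb thick v Cv = ≤∧≢⇒< (nonempty (connected P Cv Cb)) (no-leaf v Cv ∘ ≡.sym)
    where
    nonempty : ∀ {v} → WalkIn C v b → 1 ≤ deg C v
    nonempty here        = ≤-trans (s≤s z≤n) thick
    nonempty {v} (step vw _) with nbrs C v | ∈-nbrs⁺ {C} vw
    ... | _ ∷ _ | _ = s≤s z≤n

theorem3p7 : ∀ {n} (G : Graph n) → Connected G → n + 1 ≤ numEdges G →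
    ∀ {k} (f : Fin k → Fin n) → Injective _≡_ _≡_ f → (∀ a → IsPivot G (f a)) →
    k ≤ 3 * (numEdges G ∸ n)
theorem3p7 {n} G conn n<E {k} f inj piv
  with prune G (card G (λ _ → true)) (λ _ → true) ≤-refl (pruned-all G conn)
... | C , P , no-leaf with branch-vertex-exists G P n<E
... | b , Cb , thick = decidable-stable (k ≤? 3 * (numEdges G ∸ n))
  -- Double negation commutes with the finite product over `Fin k`, so all charges become available
  -- at once.
  λ k≰ → sequence rawApplicative (λ a → pivot-charge Cb thick (piv a)) λ charge →
    k≰ (bound (charge-bound min-deg f inj charge))
  where
  open RawMonad ¬¬-Monad using (rawApplicative)
  min-deg : ∀ v → C v ≡ true → 2 ≤ deg G C v
  min-deg = deg≥2 G P no-leaf Cb thick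
  C-dense : Dense G (λ v → C v ≡ true)
  C-dense v Cv = two-nbrs G C v (min-deg v Cv)
  open Core G P C-dense
  E : ℕ
  E = numEdges G
  -- Three times `euler` eliminates the darts. Cancelling `6 * card G C` and halving leaves
  -- `k + 3 * n ≤ 3 * E`, from which the truncated difference follows.
  bound : k * 2 + 6 * card G C ≤ 3 * darts G C → k ≤ 3 * (E ∸ n)
  bound le = ≤-trans (m+n≤o⇒m≤o∸n k (*-cancelʳ-≤ (k + 3 * n) (3 * E) 2 (+-cancelʳ-≤ (6 * card G C) _ _ (begin
    (k + 3 * n) * 2 + 6 * card G C      ≡⟨ lhs k n (card G C) ⟩
    k * 2 + 6 * card G C + 6 * n        ≤⟨ +-monoˡ-≤ (6 * n) le ⟩
    3 * darts G C + 6 * n               ≡⟨ mid (darts G C) n ⟩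
    3 * (darts G C + 2 * n)             ≡⟨ cong (3 *_) (Pruned.euler P) ⟩
    3 * (2 * E + 2 * card G C)          ≡⟨ rhs E (card G C) ⟩
    3 * E * 2 + 6 * card G C            ∎)))) (≤-reflexive (≡.sym (*-distribˡ-∸ 3 E n)))
    where
    open ≤-Reasoning
    lhs : ∀ k n c → (k + 3 * n) * 2 + 6 * c ≡ k * 2 + 6 * c + 6 * n
    lhs = solve-∀
    mid : ∀ d n → 3 * d + 6 * n ≡ 3 * (d + 2 * n)
    mid = solve-∀
    rhs : ∀ e c → 3 * (2 * e + 2 * c) ≡ 3 * e * 2 + 6 * c
    rhs = solve-∀
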